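{- Every acyclic type is homologically acyclic.
   Context: We work in homotopy type theory (HoTT) in the style of the HoTT Book: dependent type theory with univalent universes (hence function extensionality) and higher inductive types such as pushouts and truncations; no classical axioms are assumed. The suspension $\Sigma A$ of a type $A$ is the pushout of $\mathbf{1} \leftarrow A \to \mathbf{1}$. A type is acyclic if its suspension is contractible. For a pointed type $X$, the reduced integral homology $\tilde{\mathrm{H}}_i(X)$ is $\pi_i(\mathrm{H}\mathbb{Z} \wedge \Sigma^\infty X)$, i.e. the sequential colimit over $n$ of the groups $\pi_{i+n}(K(\mathbb{Z},n) \wedge X)$, where $K(\mathbb{Z},n)$ are the Eilenberg–MacLane types, $\wedge$ is the smash product of pointed types, and the transition maps come from the spectrum structure maps $\Sigma K(\mathbb{Z},n) \to K(\mathbb{Z},n+1)$. For an unpointed type $A$, unreduced homology is $\mathrm{H}_i(A) := \tilde{\mathrm{H}}_i(A_+)$ with $A_+ = A + \mathbf{1}$ pointed at the added point. A type $A$ is homologically $k$-acyclic if $A$ is inhabited and $\tilde{\mathrm{H}}_i(A) = 0$ for all $i \le k$ and any choice of base point (equivalently: $A$ is inhabited and $A \to \mathbf{1}$ induces isomorphisms $\mathrm{H}_i(A) \to \mathrm{H}_i(\mathbf{1})$ for $i \le k$). A type is homologically acyclic if it is homologically $k$-acyclic for all $k$. -}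

{-# OPTIONS --without-K #-}

-- Homotopy type theory is rendered inside intensional type theory without K:
-- types are the universes Set ℓ, identity types are _≡_, and univalence and the
-- higher inductive types in use are collected in the record HoTT, over which
-- everything else is parametrised.

module Defs where

open import Level using (Level; _⊔_; 0ℓ; Setω) renaming (suc to lsuc)
open import Algebra.Bundles using (Group)
open import Algebra.Morphism.Bundles using (GroupHomomorphism)
open import Data.Bool.Base using (Bool; true; false)
open import Data.Integer.Base using (ℤ; +_; -[1+_]; 0ℤ; _≤_)
open import Data.Nat.Base using (ℕ; zero; suc; _+_)
open import Data.Product.Base using (Σ; _×_; _,_; uncurry)
open import Data.Unit.Base using (⊤; tt)
open import Function.Base using (id; _∘_)
open import Relation.Binary.PropositionalEquality.Core
  using (_≡_; refl; sym; trans; cong; cong₂; subst)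
open import Relation.Binary.PropositionalEquality.Properties
  using (isEquivalence; dcong; trans-assoc; trans-reflʳ; trans-symˡ; trans-symʳ;
         module ≡-Reasoning)

private
  variable
    a b c d ℓ ℓ₁ ℓ₂ ℓ₃ : Level
    A B C S : Set a

------------------------------------------------------------------------
-- Truncation levels, equivalences, univalence

isContr : Set ℓ → Set ℓ
isContr A = Σ A λ x → ∀ y → x ≡ y

-- Indices are shifted by two: IsTrunc n A says that A is an (n-2)-type, so
-- IsTrunc 1 and IsTrunc 2 are the propositions and the sets.
IsTrunc : ℕ → Set ℓ → Set ℓ
IsTrunc zero    A = isContr A
IsTrunc (suc n) A = (x y : A) → IsTrunc n (x ≡ y)

IsProp⇒IsSet : IsTrunc 1 A → IsTrunc 2 A
IsProp⇒IsSet h x y p q with c , u ← h x y =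
  trans (sym (u p)) (u q) , λ { refl → trans-symˡ (u p) }

isEquiv : {A : Set a} {B : Set b} → (A → B) → Set (a ⊔ b)
isEquiv {A = A} f = ∀ y → isContr (Σ A λ x → f x ≡ y)

_≃_ : Set a → Set b → Set (a ⊔ b)
A ≃ B = Σ (A → B) isEquiv

idIsEquiv : isEquiv (id {A = A})
idIsEquiv y = (y , refl) , λ { (_ , refl) → refl }

idToEquiv : {A B : Set ℓ} → A ≡ B → A ≃ B
idToEquiv refl = id , idIsEquiv

------------------------------------------------------------------------
-- The axioms

-- The computation rules of the higher inductive types, including those for
-- point constructors, are identifications rather than judgmental equalities.

record PushoutSection
  {A : Set a} {B : Set b} {C : Set c} {f : C → A} {g : C → B} {Q : Set d}
  (inl : A → Q) (inr : B → Q) (glue : ∀ z → inl (f z) ≡ inr (g z))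
  (P : Q → Set ℓ) (l : ∀ x → P (inl x)) (r : ∀ y → P (inr y))
  (h : ∀ z → subst P (glue z) (l (f z)) ≡ r (g z)) :
  Set (a ⊔ b ⊔ c ⊔ d ⊔ ℓ) where
  field
    section : ∀ q → P q
    on-inl  : ∀ x → section (inl x) ≡ l x
    on-inr  : ∀ y → section (inr y) ≡ r y
    on-glue : ∀ z → trans (dcong section (glue z)) (on-inr (g z)) ≡
                    trans (cong (subst P (glue z)) (on-inl (f z))) (h z)

open PushoutSection

record HoTT : Setω where
  field
    univalence : ∀ {ℓ} {A B : Set ℓ} → isEquiv (idToEquiv {A = A} {B = B})

    Pushout : ∀ {a b c} {A : Set a} {B : Set b} {C : Set c} →
              (C → A) → (C → B) → Set (a ⊔ b ⊔ c)
    inl  : ∀ {a b c} {A : Set a} {B : Set b} {C : Set c} {f : C → A} {g : C → B} →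
           A → Pushout f g
    inr  : ∀ {a b c} {A : Set a} {B : Set b} {C : Set c} {f : C → A} {g : C → B} →
           B → Pushout f g
    glue : ∀ {a b c} {A : Set a} {B : Set b} {C : Set c} {f : C → A} {g : C → B} →
           ∀ z → inl {f = f} {g} (f z) ≡ inr (g z)
    Pushout-elim :
      ∀ {a b c ℓ} {A : Set a} {B : Set b} {C : Set c} {f : C → A} {g : C → B}
      (P : Pushout f g → Set ℓ) (l : ∀ x → P (inl x)) (r : ∀ y → P (inr y))
      (h : ∀ z → subst P (glue z) (l (f z)) ≡ r (g z)) →
      PushoutSection inl inr glue P l r h

    -- Trunc n is the (n-2)-truncation.
    Trunc : ∀ {ℓ} → ℕ → Set ℓ → Set ℓ
    [_] : ∀ {ℓ n} {A : Set ℓ} → A → Trunc n A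
    Trunc-isTrunc : ∀ {ℓ n} {A : Set ℓ} → IsTrunc n (Trunc n A)
    Trunc-elim : ∀ {ℓ ℓ' n} {A : Set ℓ} (P : Trunc n A → Set ℓ') →
                 (∀ x → IsTrunc n (P x)) → (∀ x → P [ x ]) → ∀ x → P x
    Trunc-elim-β : ∀ {ℓ ℓ' n} {A : Set ℓ} (P : Trunc n A → Set ℓ')
                   (t : ∀ x → IsTrunc n (P x)) (f : ∀ x → P [ x ]) →
                   ∀ x → Trunc-elim P t f [ x ] ≡ f x

------------------------------------------------------------------------
-- Path algebra

subst-const : {x y : A} (p : x ≡ y) (s : S) → subst (λ _ → S) p s ≡ s
subst-const refl s = refl

-- From the dependent to the non-dependent path computation rule.
dcong-const : (F : A → S) {x y : A} (p : x ≡ y) {u v : S}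
              (βx : F x ≡ u) (βy : F y ≡ v) (h : u ≡ v) →
              trans (dcong F p) βy ≡
              trans (cong (subst (λ _ → S) p) βx) (trans (subst-const p u) h) →
              trans (cong F p) βy ≡ trans βx h
dcong-const F refl refl βy h e = e

-- The following two lemmas concern a path g of W lying (via e) over the constant
-- path at p.
glue-lemma : {W : Set a} {P : Set b} {S : Set c} (m : W → P) (i : P → S)
             {s : S} (γ : ∀ w → i (m w) ≡ s)
             {w w' : W} (g : w ≡ w') {p : P} (α : m w ≡ p) (β : m w' ≡ p) →
             trans (cong m g) β ≡ trans α refl →
             trans (cong i (sym α)) (γ w) ≡ trans (cong i (sym β)) (γ w')
glue-lemma m i γ refl refl refl refl = refl

rec-lemma : {W : Set a} {P : Set b} {S : Set c} (m : W → P) (i : P → S)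
            {s : S} {w w' : W} (g : w ≡ w') {p : P}
            (α : m w ≡ p) (β : m w' ≡ p) →
            trans (cong m g) β ≡ trans α refl →
            {l r : i p ≡ s} → l ≡ r →
            subst (λ v → s ≡ i (m v)) g (trans (sym l) (cong i (sym α))) ≡
            trans (sym r) (cong i (sym β))
rec-lemma m i refl refl refl refl refl = refl

-- For F homotopic to a constant function, conjugating by the homotopy makes
-- the image of any path trivial.
null-conj : (F : A → S) {s : S} (h : ∀ x → F x ≡ s) {x y : A} (u : x ≡ y) →
            trans (sym (h x)) (trans (cong F u) (h y)) ≡ refl
null-conj F h {x} refl = trans-symˡ (h x)

null-conj-coh : (F : A → S) {s : S} (h : ∀ x → F x ≡ s) {x : A}
                {p : F x ≡ s} (q : h x ≡ p) {u : x ≡ x} (e : u ≡ refl) →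
                trans (cong (λ k → trans (sym k) (trans (cong F u) k)) (sym q))
                      (null-conj F h u) ≡
                trans (cong (λ v → trans (sym p) (trans (cong F v) p)) e)
                      (trans-symˡ p)
null-conj-coh F h refl refl = refl

------------------------------------------------------------------------
-- Pointed types

record Pointed ℓ : Set (lsuc ℓ) where
  constructor pointed
  field
    type : Set ℓ
    pt   : type

open Pointed public

infix 4 _→∙_
record _→∙_ (X : Pointed ℓ₁) (Y : Pointed ℓ₂) : Set (ℓ₁ ⊔ ℓ₂) where
  constructor pointed
  field
    map    : type X → type Y
    map-pt : map (pt X) ≡ pt Y

open _→∙_ public

infixr 9 _∘∙_
_∘∙_ : {X : Pointed ℓ₁} {Y : Pointed ℓ₂} {Z : Pointed ℓ₃} →
       (Y →∙ Z) → (X →∙ Y) → (X →∙ Z)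
g ∘∙ f = pointed (map g ∘ map f) (trans (cong (map g) (map-pt f)) (map-pt g))

Ω : Pointed ℓ → Pointed ℓ
Ω X = pointed (pt X ≡ pt X) refl

Ω^ : ℕ → Pointed ℓ → Pointed ℓ
Ω^ zero    X = X
Ω^ (suc k) X = Ω^ k (Ω X)

Ω-map : {X : Pointed ℓ₁} {Y : Pointed ℓ₂} → (X →∙ Y) → (Ω X →∙ Ω Y)
Ω-map f = pointed (λ p → trans (sym (map-pt f)) (trans (cong (map f) p) (map-pt f)))
                  (trans-symˡ (map-pt f))

Ω^-map : {X : Pointed ℓ₁} {Y : Pointed ℓ₂} (k : ℕ) → (X →∙ Y) → (Ω^ k X →∙ Ω^ k Y)
Ω^-map zero    f = f
Ω^-map (suc k) f = Ω^-map k (Ω-map f)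

Ω-map-trans : {X : Pointed ℓ₁} {Y : Pointed ℓ₂} (f : X →∙ Y) (p q : type (Ω X)) →
              map (Ω-map f) (trans p q) ≡ trans (map (Ω-map f) p) (map (Ω-map f) q)
Ω-map-trans f p q = go (map f) p q (map-pt f) (map-pt f) (map-pt f)
  where
  go : {A : Set a} {S : Set b} (F : A → S) {x y z : A} (p : x ≡ y) (q : y ≡ z)
       {u v w : S} (k : F x ≡ u) (l : F y ≡ v) (m : F z ≡ w) →
       trans (sym k) (trans (cong F (trans p q)) m) ≡
       trans (trans (sym k) (trans (cong F p) l)) (trans (sym l) (trans (cong F q) m))
  go F refl refl refl refl refl = refl

Ω-map-sym : {X : Pointed ℓ₁} {Y : Pointed ℓ₂} (f : X →∙ Y) (p : type (Ω X)) →
            map (Ω-map f) (sym p) ≡ sym (map (Ω-map f) p)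
Ω-map-sym f p = go (map f) p (map-pt f) (map-pt f)
  where
  go : {A : Set a} {S : Set b} (F : A → S) {x y : A} (p : x ≡ y)
       {u v : S} (k : F x ≡ u) (l : F y ≡ v) →
       trans (sym l) (trans (cong F (sym p)) k) ≡ sym (trans (sym k) (trans (cong F p) l))
  go F refl refl refl = refl

------------------------------------------------------------------------
-- Groups and their sequential colimits

IsTrivial : Group c ℓ → Set (c ⊔ ℓ)
IsTrivial G = ∀ x → x ≈ ε
  where open Group G using (_≈_; ε)

record GroupSequence c ℓ : Set (lsuc (c ⊔ ℓ)) where
  field
    group : ℕ → Group c ℓ
    step  : ∀ m → GroupHomomorphism (Group.rawGroup (group m))
                                    (Group.rawGroup (group (suc m)))

-- The colimit is presented by generators and relations: the elements of all the
-- groups generate it, subject to the relations of each group and to the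
-- identification of each element with its image in the next group.
module _ (𝔾 : GroupSequence c ℓ) where
  open GroupSequence 𝔾
  private
    module G (m : ℕ) = Group (group m)
    module F (m : ℕ) = GroupHomomorphism (step m)

  infix  8 _⁻¹
  infixl 7 _∙_
  data Word : Set c where
    ι   : ∀ m → G.Carrier m → Word
    _∙_ : Word → Word → Word
    ε   : Word
    _⁻¹ : Word → Word

  infix 4 _∼_
  data _∼_ : Word → Word → Set (c ⊔ ℓ) where
    ∼-refl    : ∀ {x} → x ∼ x
    ∼-sym     : ∀ {x y} → x ∼ y → y ∼ x
    ∼-trans   : ∀ {x y z} → x ∼ y → y ∼ z → x ∼ z
    ∙-cong    : ∀ {x x' y y'} → x ∼ x' → y ∼ y' → (x ∙ y) ∼ (x' ∙ y')
    ⁻¹-cong   : ∀ {x x'} → x ∼ x' → (x ⁻¹) ∼ (x' ⁻¹)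
    assoc     : ∀ x y z → ((x ∙ y) ∙ z) ∼ (x ∙ (y ∙ z))
    identityˡ : ∀ x → (ε ∙ x) ∼ x
    identityʳ : ∀ x → (x ∙ ε) ∼ x
    inverseˡ  : ∀ x → ((x ⁻¹) ∙ x) ∼ ε
    inverseʳ  : ∀ x → (x ∙ (x ⁻¹)) ∼ ε
    ι-cong    : ∀ m {x y} → G._≈_ m x y → ι m x ∼ ι m y
    ι-homo    : ∀ m x y → ι m (G._∙_ m x y) ∼ (ι m x ∙ ι m y)
    ι-step    : ∀ m x → ι (suc m) (F.⟦_⟧ m x) ∼ ι m x

  colim : Group c (c ⊔ ℓ)
  colim = record
    { Carrier = Word
    ; _≈_     = _∼_
    ; _∙_     = _∙_
    ; ε       = ε
    ; _⁻¹     = _⁻¹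
    ; isGroup = record
      { isMonoid = record
        { isSemigroup = record
          { isMagma = record
            { isEquivalence = record { refl = ∼-refl ; sym = ∼-sym ; trans = ∼-trans }
            ; ∙-cong        = ∙-cong
            }
          ; assoc = assoc
          }
        ; identity = identityˡ , identityʳ
        }
      ; inverse = inverseˡ , inverseʳ
      ; ⁻¹-cong = ⁻¹-cong
      }
    }

------------------------------------------------------------------------

module Theory (H : HoTT) where
  open HoTT H public

  -- Non-dependent elimination

  module _ {A : Set a} {B : Set b} {C : Set c} {f : C → A} {g : C → B} {S : Set d}
           (l : A → S) (r : B → S) (h : ∀ z → l (f z) ≡ r (g z)) where

    private
      h' : ∀ z → subst (λ _ → S) (glue {f = f} {g} z) (l (f z)) ≡ r (g z)
      h' z = trans (subst-const (glue z) (l (f z))) (h z)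

    Pushout-rec : Pushout f g → S
    Pushout-rec = section (Pushout-elim (λ _ → S) l r h')

    Pushout-rec-inl : ∀ x → Pushout-rec (inl x) ≡ l x
    Pushout-rec-inl = on-inl (Pushout-elim (λ _ → S) l r h')

    Pushout-rec-inr : ∀ y → Pushout-rec (inr y) ≡ r y
    Pushout-rec-inr = on-inr (Pushout-elim (λ _ → S) l r h')

    Pushout-rec-glue : ∀ z → trans (cong Pushout-rec (glue z)) (Pushout-rec-inr (g z)) ≡
                             trans (Pushout-rec-inl (f z)) (h z)
    Pushout-rec-glue z =
      dcong-const Pushout-rec (glue z) (Pushout-rec-inl (f z)) (Pushout-rec-inr (g z)) (h z)
                  (on-glue (Pushout-elim (λ _ → S) l r h') z)

  Trunc-rec : ∀ {n} {A : Set a} {S : Set b} → IsTrunc n S → (A → S) → Trunc n A → S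
  Trunc-rec t f = Trunc-elim _ (λ _ → t) f

  Trunc-rec-β : ∀ {n} {A : Set a} {S : Set b} (t : IsTrunc n S) (f : A → S) (x : A) →
                Trunc-rec t f [ x ] ≡ f x
  Trunc-rec-β t f = Trunc-elim-β _ (λ _ → t) f

  Trunc-map : ∀ {n} {A : Set a} {B : Set b} → (A → B) → Trunc n A → Trunc n B
  Trunc-map f = Trunc-rec Trunc-isTrunc (λ x → [ f x ])

  -- Functions into a set that agree on points of a set truncation are equal.
  Trunc-ind-≡ : {A : Set a} {B : Set b} (F G : Trunc 2 A → Trunc 2 B) →
                (∀ x → F [ x ] ≡ G [ x ]) → ∀ x → F x ≡ G x
  Trunc-ind-≡ F G = Trunc-elim _ (λ x → IsProp⇒IsSet (Trunc-isTrunc (F x) (G x)))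

  -- Suspensions

  Susp : Set ℓ → Set ℓ
  Susp A = Pushout {A = ⊤} {B = ⊤} {C = A} (λ _ → tt) (λ _ → tt)

  north south : Susp A
  north = inl tt
  south = inr tt

  merid : A → north {A = A} ≡ south
  merid = glue

  Susp∙ : Pointed ℓ → Pointed ℓ
  Susp∙ X = pointed (Susp (type X)) north

  Susp-rec : {A : Set a} {Y : Pointed ℓ} → (A → type (Ω Y)) → (pointed (Susp A) north →∙ Y)
  Susp-rec {Y = Y} l = pointed (Pushout-rec (λ _ → pt Y) (λ _ → pt Y) l)
                               (Pushout-rec-inl (λ _ → pt Y) (λ _ → pt Y) l tt)

  σ : (X : Pointed ℓ) → X →∙ Ω (Susp∙ X)
  σ X = pointed (λ x → trans (merid x) (sym (merid (pt X)))) (trans-symʳ (merid (pt X)))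

  -- Smash products: the cofiber of the inclusion of the wedge into the product

  Wedge : Pointed ℓ₁ → Pointed ℓ₂ → Set (ℓ₁ ⊔ ℓ₂)
  Wedge X Y = Pushout {C = ⊤} (λ _ → pt X) (λ _ → pt Y)

  Cofiber : {A : Set a} {B : Set b} → (A → B) → Set (a ⊔ b)
  Cofiber f = Pushout {A = ⊤} (λ _ → tt) f

  module _ (X : Pointed ℓ₁) (Y : Pointed ℓ₂) where

    private
      l : type X → type X × type Y
      l x = x , pt Y

      r : type Y → type X × type Y
      r y = pt X , y

      h : ⊤ → l (pt X) ≡ r (pt Y)
      h _ = refl

    wedgeIncl : Wedge X Y → type X × type Y
    wedgeIncl = Pushout-rec l r h

    wedgeIncl-inl : ∀ x → wedgeIncl (inl x) ≡ (x , pt Y)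
    wedgeIncl-inl = Pushout-rec-inl l r h

    wedgeIncl-inr : ∀ y → wedgeIncl (inr y) ≡ (pt X , y)
    wedgeIncl-inr = Pushout-rec-inr l r h

    wedgeIncl-glue : trans (cong wedgeIncl (glue tt)) (wedgeIncl-inr (pt Y)) ≡
                     trans (wedgeIncl-inl (pt X)) refl
    wedgeIncl-glue = Pushout-rec-glue l r h tt

    infixr 7 _∧_
    _∧_ : Pointed (ℓ₁ ⊔ ℓ₂)
    _∧_ = pointed (Cofiber wedgeIncl) (inl tt)

    pair : type X × type Y → type _∧_
    pair = inr

    collapse : ∀ w → pair (wedgeIncl w) ≡ pt _∧_
    collapse w = sym (glue w)

    collapseˡ : ∀ x → pair (x , pt Y) ≡ pt _∧_
    collapseˡ x = trans (cong pair (sym (wedgeIncl-inl x))) (collapse (inl x))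

    collapseʳ : ∀ y → pair (pt X , y) ≡ pt _∧_
    collapseʳ y = trans (cong pair (sym (wedgeIncl-inr y))) (collapse (inr y))

    collapse-coh : collapseˡ (pt X) ≡ collapseʳ (pt Y)
    collapse-coh = glue-lemma wedgeIncl pair collapse (glue tt)
                              (wedgeIncl-inl (pt X)) (wedgeIncl-inr (pt Y)) wedgeIncl-glue

    ∧-rec : (Z : Pointed ℓ₃) (f : type X → type Y → type Z)
            (l : ∀ x → f x (pt Y) ≡ pt Z) (r : ∀ y → f (pt X) y ≡ pt Z) →
            l (pt X) ≡ r (pt Y) → _∧_ →∙ Z
    ∧-rec Z f l r coh =
      pointed (Pushout-rec (λ _ → pt Z) (uncurry f) k)
              (Pushout-rec-inl (λ _ → pt Z) (uncurry f) k tt)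
      where
      k : ∀ w → pt Z ≡ uncurry f (wedgeIncl w)
      k = section (Pushout-elim _
        (λ x → trans (sym (l x)) (cong (uncurry f) (sym (wedgeIncl-inl x))))
        (λ y → trans (sym (r y)) (cong (uncurry f) (sym (wedgeIncl-inr y))))
        (λ _ → rec-lemma wedgeIncl (uncurry f) (glue tt)
                         (wedgeIncl-inl (pt X)) (wedgeIncl-inr (pt Y)) wedgeIncl-glue coh))

  -- The functorial action in the left factor
  ∧-mapˡ : {X : Pointed ℓ₁} {X' : Pointed ℓ₂} → (X →∙ X') →
           (Y : Pointed ℓ₃) → (X ∧ Y) →∙ (X' ∧ Y)
  ∧-mapˡ {X = X} {X'} f Y =
    ∧-rec X Y (X' ∧ Y) (λ x y → pair X' Y (map f x , y))
      (λ x → collapseˡ X' Y (map f x))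
      (λ y → trans (cong (λ x → pair X' Y (x , y)) (map-pt f)) (collapseʳ X' Y y))
      (trans (natural (map-pt f))
             (cong (trans (cong (λ x → pair X' Y (x , pt Y)) (map-pt f))) (collapse-coh X' Y)))
    where
    natural : {x x' : type X'} (p : x ≡ x') →
              collapseˡ X' Y x ≡
              trans (cong (λ x → pair X' Y (x , pt Y)) p) (collapseˡ X' Y x')
    natural refl = refl

  -- The canonical map Σ(X ∧ Y) → ΣX ∧ Y. It sends the meridian of (x , y) to the
  -- loop of ΣX ∧ Y obtained by pairing the loop σ x of ΣX with y.
  Susp-∧ : (X : Pointed ℓ₁) (Y : Pointed ℓ₂) → Susp∙ (X ∧ Y) →∙ (Susp∙ X ∧ Y)
  Susp-∧ X Y = Susp-rec (map loops)
    where
    ΣX = Susp∙ X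

    loops : (X ∧ Y) →∙ Ω (ΣX ∧ Y)
    loops = ∧-rec X Y (Ω (ΣX ∧ Y))
      (λ x y → trans (sym (collapseʳ ΣX Y y))
                 (trans (cong (λ z → pair ΣX Y (z , y)) (map (σ X) x)) (collapseʳ ΣX Y y)))
      (λ x → trans
        (cong (λ k → trans (sym k) (trans (cong (λ z → pair ΣX Y (z , pt Y)) (map (σ X) x)) k))
              (sym (collapse-coh ΣX Y)))
        (null-conj (λ z → pair ΣX Y (z , pt Y)) (collapseˡ ΣX Y) (map (σ X) x)))
      (λ y → trans
        (cong (λ v → trans (sym (collapseʳ ΣX Y y))
                       (trans (cong (λ z → pair ΣX Y (z , y)) v) (collapseʳ ΣX Y y)))
              (map-pt (σ X)))
        (trans-symˡ (collapseʳ ΣX Y y)))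
      (null-conj-coh (λ z → pair ΣX Y (z , pt Y)) (collapseˡ ΣX Y)
                     (collapse-coh ΣX Y) (map-pt (σ X)))

  -- Homotopy groups

  -- π₁₊ k X is π_{k+1}(X); as Ω^{k+1} X = Ω(Ω^k X) only propositionally, the
  -- latter form is used for its visible group structure.
  π₁₊ : ℕ → Pointed ℓ → Group ℓ ℓ
  π₁₊ k X = record
    { Carrier = Trunc 2 (type (Ω (Ω^ k X)))
    ; _≈_     = _≡_
    ; _∙_     = mul
    ; ε       = [ refl ]
    ; _⁻¹     = inv
    ; isGroup = record
      { isMonoid = record
        { isSemigroup = record
          { isMagma = record { isEquivalence = isEquivalence ; ∙-cong = cong₂ mul }
          ; assoc = mul-assoc
          }
        ; identity = mul-identityˡ , mul-identityʳ
        }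
      ; inverse = mul-inverseˡ , mul-inverseʳ
      ; ⁻¹-cong = cong inv
      }
    }
    where
    L = type (Ω (Ω^ k X))

    mul : Trunc 2 L → Trunc 2 L → Trunc 2 L
    mul x y = Trunc-rec Trunc-isTrunc (λ p → Trunc-map (trans p) y) x

    inv : Trunc 2 L → Trunc 2 L
    inv = Trunc-map sym

    mul-β : ∀ p q → mul [ p ] [ q ] ≡ [ trans p q ]
    mul-β p q = trans (Trunc-rec-β _ _ p) (Trunc-rec-β _ _ q)

    inv-β : ∀ p → inv [ p ] ≡ [ sym p ]
    inv-β = Trunc-rec-β _ _

    mul-assoc : ∀ x y z → mul (mul x y) z ≡ mul x (mul y z)
    mul-assoc x y z =
      Trunc-ind-≡ (λ x → mul (mul x y) z) (λ x → mul x (mul y z)) (λ p →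
      Trunc-ind-≡ (λ y → mul (mul [ p ] y) z) (λ y → mul [ p ] (mul y z)) (λ q →
      Trunc-ind-≡ (λ z → mul (mul [ p ] [ q ]) z) (λ z → mul [ p ] (mul [ q ] z)) (λ r →
        begin
          mul (mul [ p ] [ q ]) [ r ]  ≡⟨ cong (λ w → mul w [ r ]) (mul-β p q) ⟩
          mul [ trans p q ] [ r ]      ≡⟨ mul-β (trans p q) r ⟩
          [ trans (trans p q) r ]      ≡⟨ cong [_] (trans-assoc p) ⟩
          [ trans p (trans q r) ]      ≡⟨ mul-β p (trans q r) ⟨
          mul [ p ] [ trans q r ]      ≡⟨ cong (mul [ p ]) (mul-β q r) ⟨
          mul [ p ] (mul [ q ] [ r ])  ∎) z) y) x
      where open ≡-Reasoning

    mul-identityˡ : ∀ x → mul [ refl ] x ≡ x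
    mul-identityˡ = Trunc-ind-≡ (mul [ refl ]) id (mul-β refl)

    mul-identityʳ : ∀ x → mul x [ refl ] ≡ x
    mul-identityʳ = Trunc-ind-≡ (λ x → mul x [ refl ]) id λ p →
      trans (mul-β p refl) (cong [_] (trans-reflʳ p))

    mul-inverseˡ : ∀ x → mul (inv x) x ≡ [ refl ]
    mul-inverseˡ = Trunc-ind-≡ (λ x → mul (inv x) x) (λ _ → [ refl ]) λ p →
      trans (cong (λ w → mul w [ p ]) (inv-β p))
            (trans (mul-β (sym p) p) (cong [_] (trans-symˡ p)))

    mul-inverseʳ : ∀ x → mul x (inv x) ≡ [ refl ]
    mul-inverseʳ = Trunc-ind-≡ (λ x → mul x (inv x)) (λ _ → [ refl ]) λ p →
      trans (cong (mul [ p ]) (inv-β p))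
            (trans (mul-β p (sym p)) (cong [_] (trans-symʳ p)))

  π₁₊-∙ : (k : ℕ) (X : Pointed ℓ) (p q : type (Ω (Ω^ k X))) →
          Group._∙_ (π₁₊ k X) [ p ] [ q ] ≡ [ trans p q ]
  π₁₊-∙ k X p q = trans (Trunc-rec-β _ _ p) (Trunc-rec-β _ _ q)

  π₁₊-map : {X : Pointed ℓ₁} {Y : Pointed ℓ₂} (k : ℕ) → (X →∙ Y) →
            GroupHomomorphism (Group.rawGroup (π₁₊ k X)) (Group.rawGroup (π₁₊ k Y))
  π₁₊-map {X = X} {Y} k f = record
    { ⟦_⟧ = ⟦_⟧
    ; isGroupHomomorphism = record
      { isMonoidHomomorphism = record
        { isMagmaHomomorphism = record
          { isRelHomomorphism = record { cong = cong ⟦_⟧ }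
          ; homo = homo
          }
        ; ε-homo = trans (⟦⟧-β refl) (cong [_] (map-pt φ))
        }
      ; ⁻¹-homo = ⁻¹-homo
      }
    }
    where
    module X = Group (π₁₊ k X)
    module Y = Group (π₁₊ k Y)

    φ : Ω (Ω^ k X) →∙ Ω (Ω^ k Y)
    φ = Ω-map (Ω^-map k f)

    ⟦_⟧ : X.Carrier → Y.Carrier
    ⟦_⟧ = Trunc-map (map φ)

    ⟦⟧-β : ∀ p → ⟦ [ p ] ⟧ ≡ [ map φ p ]
    ⟦⟧-β = Trunc-rec-β _ _

    homo : ∀ x y → ⟦ x X.∙ y ⟧ ≡ ⟦ x ⟧ Y.∙ ⟦ y ⟧
    homo x y =
      Trunc-ind-≡ (λ x → ⟦ x X.∙ y ⟧) (λ x → ⟦ x ⟧ Y.∙ ⟦ y ⟧) (λ p →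
      Trunc-ind-≡ (λ y → ⟦ [ p ] X.∙ y ⟧) (λ y → ⟦ [ p ] ⟧ Y.∙ ⟦ y ⟧) (λ q →
        begin
          ⟦ [ p ] X.∙ [ q ] ⟧          ≡⟨ cong ⟦_⟧ (π₁₊-∙ k X p q) ⟩
          ⟦ [ trans p q ] ⟧            ≡⟨ ⟦⟧-β (trans p q) ⟩
          [ map φ (trans p q) ]        ≡⟨ cong [_] (Ω-map-trans (Ω^-map k f) p q) ⟩
          [ trans (map φ p) (map φ q) ] ≡⟨ π₁₊-∙ k Y (map φ p) (map φ q) ⟨
          [ map φ p ] Y.∙ [ map φ q ]  ≡⟨ cong₂ Y._∙_ (⟦⟧-β p) (⟦⟧-β q) ⟨
          ⟦ [ p ] ⟧ Y.∙ ⟦ [ q ] ⟧      ∎) y) x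
      where open ≡-Reasoning

    ⁻¹-homo : ∀ x → ⟦ x X.⁻¹ ⟧ ≡ ⟦ x ⟧ Y.⁻¹
    ⁻¹-homo = Trunc-ind-≡ (λ x → ⟦ x X.⁻¹ ⟧) (λ x → ⟦ x ⟧ Y.⁻¹) λ p →
      begin
        ⟦ [ p ] X.⁻¹ ⟧        ≡⟨ cong ⟦_⟧ (Trunc-rec-β _ _ p) ⟩
        ⟦ [ sym p ] ⟧         ≡⟨ ⟦⟧-β (sym p) ⟩
        [ map φ (sym p) ]     ≡⟨ cong [_] (Ω-map-sym (Ω^-map k f) p) ⟩
        [ sym (map φ p) ]     ≡⟨ Trunc-rec-β _ _ (map φ p) ⟨
        [ map φ p ] Y.⁻¹      ≡⟨ cong Y._⁻¹ (⟦⟧-β p) ⟨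
        ⟦ [ p ] ⟧ Y.⁻¹        ∎
      where open ≡-Reasoning

  -- Spheres and the Eilenberg–MacLane spectrum of ℤ

  Sphere : ℕ → Pointed 0ℓ
  Sphere zero    = pointed Bool true
  Sphere (suc n) = Susp∙ (Sphere n)

  -- K(ℤ,n) is the n-truncation of the n-sphere for n ≥ 1.
  K : ℕ → Pointed 0ℓ
  K zero    = pointed ℤ 0ℤ
  K (suc n) = pointed (Trunc (3 + n) (type (Sphere (suc n)))) [ pt (Sphere (suc n)) ]

  [σ] : ∀ n → type (Sphere n) → type (Ω (K (suc n)))
  [σ] n s = cong [_] (map (σ (Sphere n)) s)

  -- In degree 0 an integer acts as the corresponding power of the generating
  -- loop of the circle.
  K-loop : ∀ n → type (K n) → type (Ω (K (suc n)))
  K-loop zero    = power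
    where
    powerℕ : ℕ → type (Ω (K 1))
    powerℕ zero    = refl
    powerℕ (suc n) = trans ([σ] 0 false) (powerℕ n)

    power : ℤ → type (Ω (K 1))
    power (+ n)    = powerℕ n
    power -[1+ n ] = sym (powerℕ (suc n))
  K-loop (suc n) = Trunc-rec (Trunc-isTrunc _ _) ([σ] (suc n))

  K-structure : ∀ n → Susp∙ (K n) →∙ K (suc n)
  K-structure n = Susp-rec (K-loop n)

  -- Reduced homology

  -- K(ℤ,n) ∧ X → Ω(Σ(K(ℤ,n) ∧ X)) → Ω(ΣK(ℤ,n) ∧ X) → Ω(K(ℤ,n+1) ∧ X)
  K∧-step : (X : Pointed ℓ) (n : ℕ) → (K n ∧ X) →∙ Ω (K (suc n) ∧ X)
  K∧-step X n = Ω-map (∧-mapˡ (K-structure n) X) ∘∙ Ω-map (Susp-∧ (K n) X) ∘∙ σ (K n ∧ X)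

  -- π_{i+n}(K(ℤ,n) ∧ X) is a group once i + n ≥ 1. The pairs (first i , excess i)
  -- are the least n ≥ 0 with this property and the corresponding i + n - 1.
  first excess : ℤ → ℕ
  first (+ zero)   = 1
  first (+ suc i)  = 0
  first -[1+ i ]   = 2 + i
  excess (+ zero)  = 0
  excess (+ suc i) = i
  excess -[1+ i ]  = 0

  -- The m-th group is π_{i+n}(K(ℤ,n) ∧ X) for n = m + first i. The transition
  -- maps use that π_{k+1}(ΩY) is π_{k+2}(Y).
  homologySequence : ℤ → Pointed ℓ → GroupSequence ℓ ℓ
  homologySequence i X = record
    { group = λ m → π₁₊ (m + excess i) (K (m + first i) ∧ X)
    ; step  = λ m → π₁₊-map (m + excess i) (K∧-step X (m + first i))
    }

  H̃ : ℤ → Pointed ℓ → Group ℓ ℓ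
  H̃ i X = colim (homologySequence i X)

  -- Acyclicity

  IsAcyclic : Set ℓ → Set ℓ
  IsAcyclic A = isContr (Susp A)

  IsHomologically_Acyclic : ℤ → Set ℓ → Set ℓ
  IsHomologically k Acyclic A =
    Trunc 1 A × (∀ (i : ℤ) → i ≤ k → (x : A) → IsTrivial (H̃ i (pointed A x)))

  IsHomologicallyAcyclic : Set ℓ → Set ℓ
  IsHomologicallyAcyclic A = ∀ k → IsHomologically k Acyclic A

{-# OPTIONS --safe #-}
{-# OPTIONS --without-K #-}

-- If X is acyclic then every map from X into an identity type is constant, since
-- it extends over the contractible type ΣX. Applied to the slices {k} × X of the
-- smash product, this shows that the meridians of Σ(Y ∧ X) all agree, so that
-- Y ∧ X is acyclic for every pointed Y. The transition maps of the sequence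
-- defining H̃ᵢ(X) factor through ΩΣ(K(ℤ,n) ∧ X), hence vanish, and so does the
-- colimit.
module Submission where

open import Defs

open import Algebra.Morphism.Bundles using (GroupHomomorphism)
open import Algebra.Bundles using (Group)
open import Data.Nat.Base using (ℕ; zero; suc; _+_)
open import Data.Product.Base using (Σ; _×_; _,_; proj₁; proj₂)
open import Data.Unit.Polymorphic.Base using (⊤; tt)
open import Data.Unit.Base using () renaming (tt to tt₀)
open import Level using (Level)
open import Relation.Binary.PropositionalEquality.Core
  using (_≡_; refl; sym; trans; cong; subst)
open import Relation.Binary.PropositionalEquality.Properties
  using (trans-symˡ; trans-assoc)

open PushoutSection

private
  variable
    a b c ℓ ℓ₁ ℓ₂ ℓ₃ : Level
    A B : Set a

isContr⇒IsProp : isContr A → IsTrunc 1 A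
isContr⇒IsProp (c , u) x y =
  trans (sym (u x)) (u y) , λ { refl → trans-symˡ (u x) }

IsProp⇒paths-equal : IsTrunc 1 A → {x y : A} (p q : x ≡ y) → p ≡ q
IsProp⇒paths-equal h p q = proj₁ (IsProp⇒IsSet h _ _ p q)

inhabitedProp-equiv : isContr A → IsTrunc 1 B → B → A ≃ B
inhabitedProp-equiv {A = A} {B = B} (c , u) h b =
  (λ _ → b) , λ y →
    (c , proj₁ (h b y)) , λ { (x , q) → fibre (u x) (proj₂ (h b y) q) }
  where
  fibre : ∀ {x x' : A} {y : B} {p q : b ≡ y} → x ≡ x' → p ≡ q →
          _≡_ {A = Σ A λ _ → b ≡ y} (x , p) (x' , q)
  fibre refl refl = refl

trans-cancelˡ : {x y z : A} (p : x ≡ y) {q r : y ≡ z} → trans p q ≡ trans p r → q ≡ r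
trans-cancelˡ refl e = e

sym-trans≡refl : {x y : A} (p : x ≡ y) {q : x ≡ y} → p ≡ q → trans (sym p) q ≡ refl
sym-trans≡refl p refl = trans-symˡ p

≡-from-sym-trans : {x y : A} (p q : x ≡ y) → trans (sym p) q ≡ refl → p ≡ q
≡-from-sym-trans refl q e = sym e

≡-from-sym-trans-β : {x y : A} (p : x ≡ y) {q : x ≡ y} (e : p ≡ q) →
                     ≡-from-sym-trans p q (sym-trans≡refl p e) ≡ e
≡-from-sym-trans-β refl refl = refl

section-over : {D : A → Set b} (s : ∀ x → D x) {x y : A} (p : x ≡ y) (e : D x) →
               s y ≡ subst D p e → s x ≡ e
section-over s refl e q = q

-- A pointed null-homotopy. The condition at the base point lets nullness pass to `Ω-map`, which
-- conjugates by `map-pt f`.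
IsNull : {X : Pointed ℓ₁} {Y : Pointed ℓ₂} → (X →∙ Y) → Set _
IsNull {X = X} {Y} f = Σ (∀ x → map f x ≡ pt Y) λ h → h (pt X) ≡ map-pt f

module _ {X : Pointed ℓ₁} {Y : Pointed ℓ₂} where

  isContr⇒IsNull : isContr (type Y) → (f : X →∙ Y) → IsNull f
  isContr⇒IsNull c f =
    (λ x → proj₁ (h (map f x) (pt Y))) , IsProp⇒paths-equal h _ _
    where h = isContr⇒IsProp c

  IsNull-∘ : {Z : Pointed ℓ₃} (g : Y →∙ Z) {f : X →∙ Y} → IsNull f → IsNull (g ∘∙ f)
  IsNull-∘ g {pointed _ _} (h , refl) =
    (λ x → trans (cong (map g) (h x)) (map-pt g)) , refl

  IsNull-Ω : {f : X →∙ Y} → IsNull f → IsNull (Ω-map f)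
  IsNull-Ω {pointed F _} (h , refl) = null-conj F h , refl

IsNull-Ω^ : {X : Pointed ℓ₁} {Y : Pointed ℓ₂} (k : ℕ) {f : X →∙ Y} →
            IsNull f → IsNull (Ω^-map k f)
IsNull-Ω^ zero    n = n
IsNull-Ω^ (suc k) n = IsNull-Ω^ k (IsNull-Ω n)

module _ (𝔾 : GroupSequence c ℓ) where
  open GroupSequence 𝔾

  colim-trivial : (∀ m x → Group._≈_ (group (suc m)) (GroupHomomorphism.⟦_⟧ (step m) x)
                                     (Group.ε (group (suc m)))) →
                  IsTrivial (colim 𝔾)
  colim-trivial null = trivial
    where
    open Group (colim 𝔾) using (_≈_)

    -- No relation states directly that `ι m` preserves the unit, but the image of the unit is
    -- idempotent, and idempotents of a group are trivial.
    ι-ε : ∀ m → ι m (Group.ε (group m)) ≈ ε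
    ι-ε m = ∼-trans (∼-sym (identityˡ e))
           (∼-trans (∙-cong (∼-sym (inverseˡ e)) ∼-refl)
           (∼-trans (assoc (e ⁻¹) e e)
           (∼-trans (∙-cong ∼-refl e∙e∼e) (inverseˡ e))))
      where
      e = ι m (Group.ε (group m))

      e∙e∼e : (e ∙ e) ≈ e
      e∙e∼e = ∼-trans (∼-sym (ι-homo m _ _))
                      (ι-cong m (Group.identityˡ (group m) _))

    trivial : ∀ x → x ≈ ε
    trivial (ι m x) = ∼-trans (∼-sym (ι-step m x))
                     (∼-trans (ι-cong (suc m) (null m x)) (ι-ε (suc m)))
    trivial (x ∙ y) = ∼-trans (∙-cong (trivial x) (trivial y)) (identityˡ ε)
    trivial ε       = ∼-refl
    trivial (x ⁻¹)  = ∼-trans (⁻¹-cong (trivial x))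
                     (∼-trans (∼-sym (identityʳ (ε ⁻¹))) (inverseˡ ε))

module _ (H : HoTT) where
  open Theory H

  -- `Code` has fibres `⊤` and `Trunc 1 A` at the poles. A point of `A` makes the latter an
  -- inhabited proposition, so univalence supplies the action on meridians. Contractibility joins
  -- the poles, and `tt` is transported along that path.
  IsAcyclic⇒inhabited : (A : Set ℓ) → IsAcyclic A → Trunc 1 A
  IsAcyclic⇒inhabited {ℓ} A acyclic =
    subst (λ S → S) (Pushout-rec-inr _ _ ⊤≡‖A‖ tt₀)
      (subst Code (proj₁ (isContr⇒IsProp acyclic north south))
        (subst (λ S → S) (sym (Pushout-rec-inl _ _ ⊤≡‖A‖ tt₀)) tt))
    where
    ⊤≡‖A‖ : A → ⊤ {ℓ} ≡ Trunc 1 A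
    ⊤≡‖A‖ x = proj₁ (proj₁ (univalence
      (inhabitedProp-equiv (tt , λ _ → refl) Trunc-isTrunc [ x ])))

    Code : Susp A → Set ℓ
    Code = Pushout-rec _ _ ⊤≡‖A‖

  -- Contracts onto `north`, reaching `south` by `merid x`. Transport along `merid y` turns `refl`
  -- into `merid y`, so the coherence is `e y`.
  merid-constant⇒IsAcyclic : (x : A) → (∀ y → merid y ≡ merid x) → IsAcyclic A
  merid-constant⇒IsAcyclic x e = north , section (Pushout-elim (λ z → north ≡ z)
    (λ _ → refl) (λ _ → merid x)
    (λ y → trans (subst-path (merid y)) (e y)))
    where
    subst-path : {w z : Susp _} (p : w ≡ z) → subst (w ≡_) p refl ≡ p
    subst-path refl = refl

  module _ {A : Set a} (acyclic : IsAcyclic A) where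

    acyclic-constant : {S : Set b} {s t : S} (u : A → s ≡ t) → ∀ x y → u x ≡ u y
    -- The computation rule for `glue` recovers `u x` from the action of the recursor on `merid x`,
    -- and parallel paths in a contractible type agree.
    acyclic-constant {S = S} {s} {t} u x y = trans-cancelˡ (Pushout-rec-inl l r u tt₀)
      (trans (sym (Pushout-rec-glue l r u x))
      (trans (cong (λ p → trans (cong (Pushout-rec l r u) p) (Pushout-rec-inr l r u tt₀))
                   (IsProp⇒paths-equal (isContr⇒IsProp acyclic) (merid x) (merid y)))
             (Pushout-rec-glue l r u y)))
      where
      l r : _ → S
      l _ = s
      r _ = t

    acyclic-extend : {S : Set b} {s t : S} (u : A → s ≡ t) (v : s ≡ t)
                     (x₀ : A) (e : u x₀ ≡ v) → Σ (∀ x → u x ≡ v) λ h → h x₀ ≡ e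
    acyclic-extend u v x₀ e =
      -- `k x₀` need not be `refl`; inserting it makes it cancel at `x₀`, leaving `e`.
      (λ x → trans (sym (k x)) (trans (k x₀) e)) ,
      trans (sym (trans-assoc (sym (k x₀)))) (cong (λ p → trans p e) (trans-symˡ (k x₀)))
      where
      k : ∀ x → u x₀ ≡ u x
      k = acyclic-constant u x₀

    -- The loops `trans (sym (h x)) (h' x)` measure the difference of the two homotopies;
    -- `acyclic-extend` trivialises them with a prescribed value at `x₀`.
    acyclic-unique : {S : Set b} {s : S} (u : A → S) (h h' : ∀ x → u x ≡ s)
                     (x₀ : A) (e : h x₀ ≡ h' x₀) → Σ (∀ x → h x ≡ h' x) λ k → k x₀ ≡ e
    acyclic-unique u h h' x₀ e
      with k , q ← acyclic-extend (λ x → trans (sym (h x)) (h' x)) refl x₀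
                                  (sym-trans≡refl (h x₀) e) =
      (λ x → ≡-from-sym-trans (h x) (h' x) (k x)) ,
      trans (cong (≡-from-sym-trans (h x₀) (h' x₀)) q) (≡-from-sym-trans-β (h x₀) e)

  ∧-acyclic : (Y : Pointed ℓ₁) (X : Pointed ℓ₂) → IsAcyclic (type X) →
              IsAcyclic (type (Y ∧ X))
  ∧-acyclic Y X acyclic = merid-constant⇒IsAcyclic (pt (Y ∧ X))
    (section (Pushout-elim P (λ _ → refl) onPairs (λ w → sym (agree w))))
    where
    P : type (Y ∧ X) → Set _
    P w = merid w ≡ merid (pt (Y ∧ X))

    D : type Y × type X → Set _
    D v = P (inr v)

    -- The values forced on the wedge once `refl` is chosen at the cone point of the cofiber.
    onWedge : ∀ w → D (wedgeIncl Y X w)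
    onWedge w = subst P (glue w) refl

    -- The value at `pt X` is prescribed so that `onPairs` matches `onWedge` on the leg `Y`.
    extension : ∀ y → Σ (∀ x → D (y , x)) λ h →
                  h (pt X) ≡ subst D (wedgeIncl-inl Y X y) (onWedge (inl y))
    extension y = acyclic-extend acyclic (λ x → merid (inr (y , x))) _ (pt X) _

    onPairs : ∀ v → D v
    onPairs (y , x) = proj₁ (extension y) x

    agreeˡ : ∀ y → onPairs (wedgeIncl Y X (inl y)) ≡ onWedge (inl y)
    agreeˡ y = section-over onPairs (wedgeIncl-inl Y X y) _ (proj₂ (extension y))

    -- On the leg `X` both sides contract the same family of meridians. The comparison is prescribed
    -- at `pt X` so that it glues with `agreeˡ`.
    agreeʳ : Σ (∀ x → onPairs (wedgeIncl Y X (inr x)) ≡ onWedge (inr x)) λ k →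
               k (pt X) ≡ subst (λ w → onPairs (wedgeIncl Y X w) ≡ onWedge w)
                                (glue tt₀) (agreeˡ (pt Y))
    agreeʳ = acyclic-unique acyclic (λ x → merid (inr (wedgeIncl Y X (inr x)))) _ _ (pt X) _

    agree : ∀ w → onPairs (wedgeIncl Y X w) ≡ onWedge w
    agree = section (Pushout-elim _ agreeˡ (proj₁ agreeʳ) (λ _ → sym (proj₂ agreeʳ)))

  K∧-step-null : (X : Pointed ℓ) → IsAcyclic (type X) → ∀ n → IsNull (K∧-step X n)
  K∧-step-null X acyclic n =
    IsNull-∘ (Ω-map (∧-mapˡ (K-structure n) X)) (IsNull-∘ (Ω-map (Susp-∧ (K n) X))
      (isContr⇒IsNull (isContr⇒IsProp (∧-acyclic (K n) X acyclic) north north)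
                      (σ (K n ∧ X))))

  π₁₊-map-null : {X : Pointed ℓ₁} {Y : Pointed ℓ₂} (k : ℕ) {f : X →∙ Y} → IsNull f →
                 ∀ x → GroupHomomorphism.⟦_⟧ (π₁₊-map k f) x ≡ [ refl ]
  π₁₊-map-null k {f} null = Trunc-ind-≡ (GroupHomomorphism.⟦_⟧ (π₁₊-map k f)) (λ _ → [ refl ])
    -- `π₁₊ k` loops `k + 1` times, hence the extra `IsNull-Ω`.
    λ p → trans (Trunc-rec-β _ _ p) (cong [_] (proj₁ (IsNull-Ω (IsNull-Ω^ k null)) p))

  H̃-trivial : (X : Pointed ℓ) → IsAcyclic (type X) → ∀ i → IsTrivial (H̃ i X)
  H̃-trivial X acyclic i = colim-trivial (homologySequence i X) λ m →
    π₁₊-map-null (m + excess i) (K∧-step-null X acyclic (m + first i))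

corollary6p3 : (H : HoTT) → let open Theory H in
    ∀ {ℓ} (A : Set ℓ) → IsAcyclic A → IsHomologicallyAcyclic A
corollary6p3 H A acyclic k =
  IsAcyclic⇒inhabited H A acyclic ,
  λ i _ x → H̃-trivial H (pointed A x) acyclic i
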